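{- There exist an open set $U\subseteq 2^\omega$ and a closed set $C\subseteq 2^\omega$ such that $\Phi(U)=\Phi(C)$ and this set is a complete $\boldsymbol{\Pi}^0_3$ set.
   Context: $2^\omega$ is the Cantor space with the product topology; for a finite binary sequence $s$, $N_s=\{x\in 2^\omega: s\subset x\}$. $\mu$ is the coin-tossing (Lebesgue) measure on $2^\omega$, i.e. the Borel probability measure with $\mu(N_s)=2^{ -\mathrm{lh}(s)}$. For a $\mu$-measurable $A\subseteq 2^\omega$, $\Phi(A)=\{x\in 2^\omega: \lim_{n\to\infty}\mu(A\cap N_{x\restriction n})/\mu(N_{x\restriction n})=1\}$ (the set of points of density $1$ in $A$). $\boldsymbol{\Pi}^0_3$ denotes the class of $F_{\sigma\delta}$ sets, $\boldsymbol{\Sigma}^0_3$ the class of $G_{\delta\sigma}$ sets, $\boldsymbol{\Delta}^0_3=\boldsymbol{\Sigma}^0_3\cap\boldsymbol{\Pi}^0_3$. A set $X\subseteq 2^\omega$ is complete $\boldsymbol{\Pi}^0_3$ if $X\in\boldsymbol{\Pi}^0_3$ and every $\boldsymbol{\Pi}^0_3$ subset of $2^\omega$ is of the form $f^{ -1}(X)$ for a continuous $f:2^\omega\to2^\omega$ (equivalently, $X\in\boldsymbol{\Pi}^0_3\setminus\boldsymbol{\Sigma}^0_3$). -}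

module Defs where

open import Data.Bool.Base using (Bool)
open import Data.List.Base using (List; []; _∷_; length; applyUpTo)
open import Data.Maybe.Base using (Maybe; just; nothing)
open import Data.Nat.Base as ℕ using (ℕ; zero; suc)
open import Data.Product.Base using (Σ-syntax; ∃-syntax; _×_)
open import Data.Rational.Base using (ℚ; 0ℚ; 1ℚ; ½; _+_; _-_; _*_; _≤_; _<_)
open import Level using (0ℓ)
open import Relation.Binary.PropositionalEquality.Core using (_≡_)
open import Relation.Unary using (Pred; _∈_; _∩_; _⊆_; _≐_; _⊢_; ∁; ⋃; ⋂)

Cantor : Set
Cantor = ℕ → Bool

𝒫 : Set₁
𝒫 = Pred Cantor 0ℓ

infix 20 _↾_

_↾_ : Cantor → ℕ → List Bool
x ↾ n = applyUpTo x n

N : List Bool → 𝒫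
N s x = x ↾ length s ≡ s

IsOpen : 𝒫 → Set
IsOpen U = ∀ x → x ∈ U → ∃[ n ] N (x ↾ n) ⊆ U

IsClosed : 𝒫 → Set
IsClosed C = IsOpen (∁ C)

Continuous : (Cantor → Cantor) → Set
Continuous f = ∀ x n → ∃[ m ] N (x ↾ m) ⊆ f ⊢ N (f x ↾ n)

-- The coin-tossing measure is the restriction, to the measurable sets, of
-- the outer measure
--   μ A = inf { Σₖ 2^(- lh sₖ) | A ⊆ ⋃ₖ N sₖ }.
-- This makes sense for every A; open and closed sets are measurable.
-- As there is no type of reals, μ A is given by its comparisons with
-- rationals.

-- 2^(- lh s)
vol : List Bool → ℚ
vol []      = 1ℚ
vol (_ ∷ s) = ½ * vol s

-- A countable (possibly finite or empty) family of basic open sets;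
-- nothing marks an unused index.
Family : Set
Family = ℕ → Maybe (List Bool)

Covers : Family → 𝒫 → Set
Covers c A = ∀ x → x ∈ A → ∃[ k ] ∃[ s ] (c k ≡ just s × x ∈ N s)

volMaybe : Maybe (List Bool) → ℚ
volMaybe (just s) = vol s
volMaybe nothing  = 0ℚ

partialSum : Family → ℕ → ℚ
partialSum c zero    = 0ℚ
partialSum c (suc n) = partialSum c n + volMaybe (c n)

-- Some cover of A has total volume (the supremum of its partial sums) at
-- most r, so that μ A is the infimum of all such r.
CoverableWithin : 𝒫 → ℚ → Set
CoverableWithin A r = ∃[ c ] (Covers c A × (∀ n → partialSum c n ≤ r))

infix 4 _≤μ_ _μ≤_

-- q ≤ μ A
_≤μ_ : ℚ → 𝒫 → Set
q ≤μ A = ∀ r → CoverableWithin A r → q ≤ r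

-- μ A ≤ q
_μ≤_ : 𝒫 → ℚ → Set
A μ≤ q = ∀ r → q < r → CoverableWithin A r

-- | μ (A ∩ N s) / μ (N s) - 1 | ≤ ε, multiplied out by μ (N s) = vol s > 0
DensityWithin : 𝒫 → ℚ → List Bool → Set
DensityWithin A ε s =
  ((1ℚ - ε) * vol s ≤μ A ∩ N s) × (A ∩ N s μ≤ (1ℚ + ε) * vol s)

Φ : 𝒫 → 𝒫
Φ A x = ∀ ε → 0ℚ < ε → ∃[ m ] (∀ n → m ℕ.≤ n → DensityWithin A ε (x ↾ n))

-- F_σδ sets
Π⁰₃ : 𝒫 → Set₁
Π⁰₃ X = Σ[ F ∈ (ℕ → ℕ → 𝒫) ]
  ((∀ i j → IsClosed (F i j)) × X ≐ (⋂[ i ∶ ℕ ] ⋃[ j ∶ ℕ ] F i j))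

CompleteΠ⁰₃ : 𝒫 → Set₁
CompleteΠ⁰₃ X = Π⁰₃ X × (∀ Y → Π⁰₃ Y → ∃[ f ] (Continuous f × Y ≐ (f ⊢ X)))

{-# OPTIONS --safe #-}
module Submission where

open import Defs
open import Axiom.ExcludedMiddle using (ExcludedMiddle)
open import Data.Bool.Base using (Bool; true; false; not; if_then_else_)
open import Data.Empty using (⊥)
import Data.Integer.Base as ℤ
import Data.Integer.Properties as ℤ
open import Data.List.Base using (List; []; _∷_; _++_; length; map)
open import Data.List.Properties using (length-applyUpTo; ∷-injective)
open import Data.List.Relation.Unary.Any as Any using (Any; here; there)
import Data.List.Relation.Unary.Any.Properties as Any
open import Data.Maybe.Base using (Maybe; just; nothing; _>>=_)
open import Data.Nat.Base as ℕ using (ℕ; zero; suc; z≤n; s≤s)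
import Data.Nat.Properties as ℕ
open import Data.Product.Base using (Σ-syntax; ∃-syntax; _×_; _,_; proj₁; proj₂)
open import Data.Rational.Base using (ℚ; 0ℚ; 1ℚ; ½; _+_; _-_; _*_; -_; toℚᵘ; _≤_; _<_; *≤*; *<*; nonNegative; positive; mkℚ)
open import Data.Rational.Properties
open import Data.Rational.Solver using (module +-*-Solver)
import Data.Rational.Unnormalised.Base as ℚᵘ
import Data.Rational.Unnormalised.Properties as ℚᵘ
open import Data.Sum.Base using (inj₁; inj₂)
open import Data.Unit.Base using (⊤; tt)
open import Function.Base using (_∘_; case_of_)
open import Function.Bundles using (mk⇔)
open import Level using (0ℓ)
open import Relation.Binary.PropositionalEquality
open import Relation.Nullary using (¬_; does; yes; no; contradiction)
open import Relation.Nullary.Decidable using (decidable-stable; does-⇔)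
open import Relation.Unary using (_≐_; _∈_; _∩_; _⊆_; ∁; ⋃; ⋂)

open +-*-Solver using (solve; con; _:=_; _:+_; _:*_; _:-_)

-- A machine reads x bit by bit and moves between levels ℓ ∈ ℕ until it is
-- absorbed, almost surely, inside U or inside V; thus U and ∁ V differ by a
-- null set.  From level ℓ the probability of ending in V is at most 2^(-ℓ), by
-- a supermartingale, and at least a positive constant depending only on ℓ.
-- Hence a point on which the machine is never absorbed has density 1 in U iff
-- the level tends to infinity.  Given F_σδ data F, a point y steers the machine:
-- in stage n it starts at a level ≥ n and descends to the least row i whose
-- current candidate j for y ∈ F i j is refuted by y ↾ n, if there is one below.
-- The level tends to infinity iff every row changes its candidate only finitely
-- often, i.e. iff y lies in ⋂ᵢ ⋃ⱼ F i j.

-- Means of two rationals and powers of one half.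

avg : ℚ → ℚ → ℚ
avg a b = ½ * (a + b)

avg-mono : ∀ {a a′ b b′} → a ≤ a′ → b ≤ b′ → avg a b ≤ avg a′ b′
avg-mono a≤a′ b≤b′ = *-monoˡ-≤-nonNeg ½ (+-mono-≤ a≤a′ b≤b′)

avg-idem : ∀ a → avg a a ≡ a
avg-idem = solve 1 (λ a → con ½ :* (a :+ a) := a) refl

avg-+ : ∀ a b c d → avg (a + c) (b + d) ≡ avg a b + avg c d
avg-+ = solve 4 (λ a b c d → con ½ :* ((a :+ c) :+ (b :+ d)) := con ½ :* (a :+ b) :+ con ½ :* (c :+ d)) refl

avg-≤ : ∀ {a b r} → a ≤ r → b ≤ r → avg a b ≤ r
avg-≤ {r = r} a≤r b≤r = ≤-trans (avg-mono a≤r b≤r) (≤-reflexive (avg-idem r))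

≤-avg : ∀ {a b r} → r ≤ a → r ≤ b → r ≤ avg a b
≤-avg {r = r} r≤a r≤b = ≤-trans (≤-reflexive (sym (avg-idem r))) (avg-mono r≤a r≤b)

avg-0 : ∀ a → avg a 0ℚ ≡ ½ * a
avg-0 a = cong (½ *_) (+-identityʳ a)

½*-≤ : ∀ {a} → 0ℚ ≤ a → ½ * a ≤ a
½*-≤ {a} 0≤a = ≤-trans (≤-reflexive (sym (avg-0 a))) (avg-≤ ≤-refl 0≤a)

½^_ : ℕ → ℚ
½^ zero  = 1ℚ
½^ suc n = ½ * ½^ n

0<½^ : ∀ n → 0ℚ < ½^ n
0<½^ zero    = positive⁻¹ 1ℚ
0<½^ (suc n) = subst (_< ½^ suc n) (*-zeroʳ ½) (*-monoʳ-<-pos ½ (0<½^ n))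

0≤½^ : ∀ n → 0ℚ ≤ ½^ n
0≤½^ n = <⇒≤ (0<½^ n)

½^-suc-≤ : ∀ n → ½^ suc n ≤ ½^ n
½^-suc-≤ n = ½*-≤ (0≤½^ n)

½^-suc-< : ∀ n → ½^ suc n < ½^ n
½^-suc-< n = begin-strict
  ½^ suc n              ≡⟨ +-identityʳ _ ⟨
  ½^ suc n + 0ℚ         <⟨ +-monoʳ-< (½^ suc n) (0<½^ (suc n)) ⟩
  ½^ suc n + ½^ suc n   ≡⟨ *-distribˡ-+ ½ (½^ n) (½^ n) ⟨
  avg (½^ n) (½^ n)     ≡⟨ avg-idem _ ⟩
  ½^ n                  ∎
  where open ≤-Reasoning

½^-+-≤ : ∀ m n → ½^ (m ℕ.+ n) ≤ ½^ n
½^-+-≤ zero    n = ≤-refl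
½^-+-≤ (suc m) n = ≤-trans (½^-suc-≤ (m ℕ.+ n)) (½^-+-≤ m n)

½^-anti : ∀ {m n} → m ℕ.≤ n → ½^ n ≤ ½^ m
½^-anti {m} {n} m≤n = subst (λ k → ½^ k ≤ ½^ m) (ℕ.m∸n+n≡m m≤n) (½^-+-≤ (n ℕ.∸ m) m)

½^≤1 : ∀ n → ½^ n ≤ 1ℚ
½^≤1 n = ½^-anti {0} {n} z≤n

ℕ→ℚ : ℕ → ℚ
ℕ→ℚ zero    = 0ℚ
ℕ→ℚ (suc n) = 1ℚ + ℕ→ℚ n

½^-*-≤1 : ∀ n → ½^ n * ℕ→ℚ n ≤ 1ℚ
½^-*-≤1 zero    = *≤* (ℤ.+≤+ z≤n)
½^-*-≤1 (suc n) = begin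
  ½^ suc n * (1ℚ + ℕ→ℚ n)       ≡⟨ solve 2 (λ h m → (con ½ :* h) :* (con 1ℚ :+ m) := con ½ :* (h :+ h :* m)) refl (½^ n) (ℕ→ℚ n) ⟩
  avg (½^ n) (½^ n * ℕ→ℚ n)     ≤⟨ avg-≤ (½^≤1 n) (½^-*-≤1 n) ⟩
  1ℚ                            ∎
  where open ≤-Reasoning

toℚᵘ-ℕ→ℚ : ∀ n → toℚᵘ (ℕ→ℚ n) ℚᵘ.≃ ℚᵘ.mkℚᵘ (ℤ.+ n) 0
toℚᵘ-ℕ→ℚ zero    = ℚᵘ.≃-refl
toℚᵘ-ℕ→ℚ (suc n) = ℚᵘ.≃-trans (toℚᵘ-homo-+ 1ℚ (ℕ→ℚ n))
  (ℚᵘ.≃-trans (ℚᵘ.+-congʳ (toℚᵘ 1ℚ) (toℚᵘ-ℕ→ℚ n)) (ℚᵘ.*≡* (cong (λ k → (ℤ.+ 1 ℤ.+ k) ℤ.* ℤ.+ 1) (ℤ.*-identityʳ (ℤ.+ n)))))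

-- A positive `ε` with denominator `suc d` satisfies `(suc d) * ε ≥ 1`. Since `½^ n * n ≤ 1`, this
-- gives `½^ suc d ≤ ε`, and one more halving makes the inequality strict.
archimedean : ∀ ε → 0ℚ < ε → ∃[ n ] ½^ n < ε
archimedean (mkℚ (ℤ.+ zero) _ _) (*<* (ℤ.+<+ ()))
archimedean (mkℚ ℤ.-[1+ _ ] _ _) (*<* ())
archimedean ε@(mkℚ ℤ.+[1+ p ] d _) 0<ε = suc (suc d) , (begin-strict
  ½^ suc (suc d)                  <⟨ ½^-suc-< (suc d) ⟩
  ½^ suc d                        ≡⟨ *-identityʳ _ ⟨
  ½^ suc d * 1ℚ                   ≤⟨ *-monoˡ-≤-nonNeg (½^ suc d) {{nonNegative (0≤½^ (suc d))}} 1≤ ⟩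
  ½^ suc d * (ℕ→ℚ (suc d) * ε)    ≡⟨ *-assoc (½^ suc d) (ℕ→ℚ (suc d)) ε ⟨
  (½^ suc d * ℕ→ℚ (suc d)) * ε    ≤⟨ *-monoʳ-≤-nonNeg ε (½^-*-≤1 (suc d)) ⟩
  1ℚ * ε                          ≡⟨ *-identityˡ ε ⟩
  ε                               ∎)
  where
  open ≤-Reasoning
  1≤ : 1ℚ ≤ ℕ→ℚ (suc d) * ε
  -- The product is compared with 1 by cross-multiplying unnormalised fractions, so that no common
  -- factors have to be cancelled.
  1≤ = toℚᵘ-cancel-≤ (ℚᵘ.≤-trans
    (ℚᵘ.*≤* (ℤ.+≤+ (ℕ.≤-trans (ℕ.≤-reflexive (ℕ.*-identityˡ _)) (ℕ.≤-trans (ℕ.≤-reflexive (ℕ.*-identityˡ _)) (ℕ.≤-trans (ℕ.m≤m*n (suc d) (suc p)) (ℕ.≤-reflexive (sym (ℕ.*-identityʳ _))))))))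
    (ℚᵘ.≤-reflexive (ℚᵘ.≃-sym (ℚᵘ.≃-trans (toℚᵘ-homo-* (ℕ→ℚ (suc d)) ε) (ℚᵘ.*-congʳ (toℚᵘ-ℕ→ℚ (suc d)))))))

≤-½^-slack : ∀ {a b} → (∀ n → a ≤ b + ½^ n) → a ≤ b
≤-½^-slack {a} {b} a≤b+½^ = ≮⇒≥ λ b<a →
  let n , ½^n<a-b = archimedean (a - b) (subst (_< a - b) (+-inverseʳ b) (+-monoˡ-< (- b) b<a))
  in <-irrefl refl (begin-strict
    a              ≤⟨ a≤b+½^ n ⟩
    b + ½^ n       <⟨ +-monoʳ-< b ½^n<a-b ⟩
    b + (a - b)    ≡⟨ +-comm b (a - b) ⟩
    (a - b) + b    ≡⟨ +-assoc a (- b) b ⟩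
    a + (- b + b)  ≡⟨ cong (a +_) (+-inverseˡ b) ⟩
    a + 0ℚ         ≡⟨ +-identityʳ a ⟩
    a              ∎)
  where open ≤-Reasoning

-- Volumes, partial sums and finite covers.

0≤vol : ∀ s → 0ℚ ≤ vol s
0≤vol []      = *≤* (ℤ.+≤+ z≤n)
0≤vol (_ ∷ s) = *-monoˡ-≤-nonNeg ½ (0≤vol s)

0<vol : ∀ s → 0ℚ < vol s
0<vol []      = positive⁻¹ 1ℚ
0<vol (_ ∷ s) = *-monoʳ-<-pos ½ (0<vol s)

vol≤1 : ∀ s → vol s ≤ 1ℚ
vol≤1 []      = ≤-refl
vol≤1 (_ ∷ s) = ≤-trans (½*-≤ (0≤vol s)) (vol≤1 s)

*-vol-mono : ∀ {a b} s → a ≤ b → a * vol s ≤ b * vol s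
*-vol-mono s = *-monoʳ-≤-nonNeg (vol s) {{nonNegative (0≤vol s)}}

*-vol-cancel : ∀ {a b} s → a * vol s ≤ b * vol s → a ≤ b
*-vol-cancel s = *-cancelʳ-≤-pos (vol s) {{positive (0<vol s)}}

0≤volMaybe : ∀ m → 0ℚ ≤ volMaybe m
0≤volMaybe (just s) = 0≤vol s
0≤volMaybe nothing  = ≤-refl

partialSum-suc : ∀ c n → partialSum c (suc n) ≡ volMaybe (c 0) + partialSum (c ∘ suc) n
partialSum-suc c zero    = +-comm 0ℚ (volMaybe (c 0))
partialSum-suc c (suc n) = begin
  partialSum c (suc n) + volMaybe (c (suc n))                            ≡⟨ cong (_+ volMaybe (c (suc n))) (partialSum-suc c n) ⟩
  (volMaybe (c 0) + partialSum (c ∘ suc) n) + volMaybe (c (suc n))       ≡⟨ +-assoc (volMaybe (c 0)) (partialSum (c ∘ suc) n) (volMaybe (c (suc n))) ⟩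
  volMaybe (c 0) + (partialSum (c ∘ suc) n + volMaybe (c (suc n)))       ∎
  where open ≡-Reasoning

partialSum-≤-suc : ∀ c n → partialSum c n ≤ partialSum c (suc n)
partialSum-≤-suc c n = ≤-trans (≤-reflexive (sym (+-identityʳ _))) (+-monoʳ-≤ (partialSum c n) (0≤volMaybe (c n)))

partialSum-mono-+ : ∀ c k n → partialSum c n ≤ partialSum c (k ℕ.+ n)
partialSum-mono-+ c zero    n = ≤-refl
partialSum-mono-+ c (suc k) n = ≤-trans (partialSum-mono-+ c k n) (partialSum-≤-suc c (k ℕ.+ n))

partialSum-mono : ∀ c {m n} → m ℕ.≤ n → partialSum c m ≤ partialSum c n
partialSum-mono c {m} {n} m≤n = subst (λ k → partialSum c m ≤ partialSum c k) (ℕ.m∸n+n≡m m≤n) (partialSum-mono-+ c (n ℕ.∸ m) m)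

0≤partialSum : ∀ c n → 0ℚ ≤ partialSum c n
0≤partialSum c n = partialSum-mono c {0} {n} z≤n

totalVol : List (List Bool) → ℚ
totalVol []      = 0ℚ
totalVol (s ∷ L) = vol s + totalVol L

totalVol-++ : ∀ L M → totalVol (L ++ M) ≡ totalVol L + totalVol M
totalVol-++ []      M = sym (+-identityˡ (totalVol M))
totalVol-++ (s ∷ L) M = trans (cong (vol s +_) (totalVol-++ L M)) (sym (+-assoc (vol s) (totalVol L) (totalVol M)))

totalVol-map : ∀ b L → totalVol (map (b ∷_) L) ≡ ½ * totalVol L
totalVol-map b []      = refl
totalVol-map b (s ∷ L) = trans (cong (½ * vol s +_) (totalVol-map b L)) (sym (*-distribˡ-+ ½ (vol s) (totalVol L)))

0≤totalVol : ∀ L → 0ℚ ≤ totalVol L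
0≤totalVol []      = ≤-refl
0≤totalVol (s ∷ L) = +-mono-≤ (0≤vol s) (0≤totalVol L)

listFamily : List (List Bool) → Family
listFamily []      _       = nothing
listFamily (s ∷ _) zero    = just s
listFamily (_ ∷ L) (suc k) = listFamily L k

partialSum-listFamily : ∀ L n → partialSum (listFamily L) n ≤ totalVol L
partialSum-listFamily L       zero    = 0≤totalVol L
partialSum-listFamily []      (suc n) = ≤-trans (≤-reflexive (+-identityʳ _)) (partialSum-listFamily [] n)
partialSum-listFamily (s ∷ L) (suc n) = ≤-trans (≤-reflexive (partialSum-suc (listFamily (s ∷ L)) n)) (+-monoʳ-≤ (vol s) (partialSum-listFamily L n))

listFamily-covers : ∀ {L x} → Any (λ s → x ∈ N s) L → ∃[ k ] ∃[ s ] (listFamily L k ≡ just s × x ∈ N s)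
listFamily-covers (here x∈s)  = 0 , _ , refl , x∈s
listFamily-covers (there x∈L) = let k , s , eq , x∈s = listFamily-covers x∈L in suc k , s , eq , x∈s

coverable-list : ∀ A L → (∀ {x} → x ∈ A → Any (λ s → x ∈ N s) L) → CoverableWithin A (totalVol L)
coverable-list A L A⊆L = listFamily L , (λ x x∈A → listFamily-covers (A⊆L x∈A)) , partialSum-listFamily L

coverable-mono : ∀ {A B r} → A ⊆ B → CoverableWithin B r → CoverableWithin A r
coverable-mono A⊆B (c , covers , bound) = c , (λ x x∈A → covers x (A⊆B x∈A)) , bound

coverable-≤ : ∀ {A r r′} → r ≤ r′ → CoverableWithin A r → CoverableWithin A r′
coverable-≤ r≤r′ (c , covers , bound) = c , covers , λ n → ≤-trans (bound n) r≤r′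

∈N-∷ : ∀ {b s x} → x 0 ≡ b → (x ∘ suc) ∈ N s → x ∈ N (b ∷ s)
∈N-∷ = cong₂ _∷_

x∈N[x↾n] : ∀ x n → x ∈ N (x ↾ n)
x∈N[x↾n] x n = cong (x ↾_) (length-applyUpTo x n)

∈N⇒↾≡ : ∀ {x y} n → y ∈ N (x ↾ n) → y ↾ n ≡ x ↾ n
∈N⇒↾≡ {x} {y} n y∈N = trans (cong (y ↾_) (sym (length-applyUpTo x n))) y∈N

-- The single box `N s` covers `A ∩ N s` at cost `vol s`, whatever `A` is.
density-upper : ∀ A {ε} s → 0ℚ ≤ ε → A ∩ N s μ≤ (1ℚ + ε) * vol s
density-upper A {ε} s 0≤ε r [1+ε]vol<r = coverable-≤ (begin
    vol s + 0ℚ          ≡⟨ +-identityʳ (vol s) ⟩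
    vol s               ≡⟨ *-identityˡ (vol s) ⟨
    1ℚ * vol s          ≡⟨ cong (_* vol s) (+-identityʳ 1ℚ) ⟨
    (1ℚ + 0ℚ) * vol s   ≤⟨ *-vol-mono s (+-monoʳ-≤ 1ℚ 0≤ε) ⟩
    (1ℚ + ε) * vol s    <⟨ [1+ε]vol<r ⟩
    r                   ∎)
  (coverable-list (A ∩ N s) (s ∷ []) (λ (_ , x∈s) → here x∈s))
  where open ≤-Reasoning

-- Restricting a family of boxes to the two halves of the space.

infixr 5 _◂_

_◂_ : Bool → Cantor → Cantor
(b ◂ x) zero    = b
(b ◂ x) (suc n) = x n

-- The empty string is kept on both sides, so that a family and its two
-- shifts satisfy partialSum-shift exactly.
strip : Bool → List Bool → Maybe (List Bool)
strip _     []          = just []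
strip false (false ∷ s) = just s
strip true  (true  ∷ s) = just s
strip _     (_ ∷ _)     = nothing

shift : Bool → Family → Family
shift b c k = c k >>= strip b

volMaybe-strip : ∀ m → volMaybe m ≡ avg (volMaybe (m >>= strip false)) (volMaybe (m >>= strip true))
volMaybe-strip nothing            = refl
volMaybe-strip (just [])          = refl
volMaybe-strip (just (false ∷ s)) = cong (½ *_) (sym (+-identityʳ (vol s)))
volMaybe-strip (just (true ∷ s))  = cong (½ *_) (sym (+-identityˡ (vol s)))

partialSum-shift : ∀ c n → partialSum c n ≡ avg (partialSum (shift false c) n) (partialSum (shift true c) n)
partialSum-shift c zero    = refl
partialSum-shift c (suc n) = trans (cong₂ _+_ (partialSum-shift c n) (volMaybe-strip (c n)))
  (sym (avg-+ (partialSum (shift false c) n) (partialSum (shift true c) n) _ _))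

strip-∷ : ∀ b s → strip b (b ∷ s) ≡ just s
strip-∷ false s = refl
strip-∷ true  s = refl

shift-covers : ∀ c b x → (∃[ k ] ∃[ s ] (c k ≡ just s × (b ◂ x) ∈ N s)) →
               ∃[ k ] ∃[ s ] (shift b c k ≡ just s × x ∈ N s)
shift-covers c b x (k , []    , eq , _)    = k , [] , cong (_>>= strip b) eq , refl
shift-covers c b x (k , a ∷ s , eq , bx∈N) with ∷-injective bx∈N
... | refl , x∈s = k , s , trans (cong (_>>= strip b) eq) (strip-∷ b s) , x∈s

partialSum-½-shift : ∀ c b n → ½ * partialSum (shift b c) n ≤ partialSum c n
partialSum-½-shift c false n = begin
  ½ * partialSum (shift false c) n                                       ≡⟨ avg-0 (partialSum (shift false c) n) ⟨
  avg (partialSum (shift false c) n) 0ℚ                                  ≤⟨ avg-mono {partialSum (shift false c) n} ≤-refl (0≤partialSum (shift true c) n) ⟩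
  avg (partialSum (shift false c) n) (partialSum (shift true c) n)       ≡⟨ partialSum-shift c n ⟨
  partialSum c n                                                         ∎
  where open ≤-Reasoning
partialSum-½-shift c true n = begin
  ½ * partialSum (shift true c) n                                        ≡⟨ cong (½ *_) (+-identityˡ (partialSum (shift true c) n)) ⟨
  avg 0ℚ (partialSum (shift true c) n)                                   ≤⟨ avg-mono (0≤partialSum (shift false c) n) ≤-refl ⟩
  avg (partialSum (shift false c) n) (partialSum (shift true c) n)       ≡⟨ partialSum-shift c n ⟨
  partialSum c n                                                         ∎
  where open ≤-Reasoning

-- Partial sums increase, so at the larger of the two indices both bounds hold together.
partialSum-combine : ∀ c {a b} → ∃[ m ] a ≤ partialSum (shift false c) m → ∃[ n ] b ≤ partialSum (shift true c) n →
                     ∃[ k ] avg a b ≤ partialSum c k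
partialSum-combine c (m , a≤) (n , b≤) = m ℕ.⊔ n , ≤-trans
  (avg-mono (≤-trans a≤ (partialSum-mono (shift false c) (ℕ.m≤m⊔n m n))) (≤-trans b≤ (partialSum-mono (shift true c) (ℕ.m≤n⊔m m n))))
  (≤-reflexive (sym (partialSum-shift c (m ℕ.⊔ n))))

-- The machine and its absorption sets.

-- A point is in U or in V once the machine, reading its bits, has entered
-- the absorbing state inside or outside.
data State : Set where
  inside outside : State
  lev mid        : (n ℓ : ℕ) → State

-- A round takes two bits. At `lev` half of the mass is absorbed inside, which makes absorption
-- almost sure. At `mid` the machine either starts the next stage, at a level no smaller than the
-- number of that stage, or drops one level; below level 0 lies `outside`.
δ : State → Bool → State
δ inside          _     = inside
δ outside         _     = outside
δ (lev n ℓ)       true  = inside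
δ (lev n ℓ)       false = mid n ℓ
δ (mid n ℓ)       true  = lev (suc n) (suc n ℕ.+ ℓ)
δ (mid n zero)    false = outside
δ (mid n (suc ℓ)) false = lev n ℓ

run : State → List Bool → State
run q []      = q
run q (b ∷ s) = run (δ q b) s

run-↾-suc : ∀ q x n → run q (x ↾ suc n) ≡ δ (run q (x ↾ n)) (x n)
run-↾-suc q x zero    = refl
run-↾-suc q x (suc n) = run-↾-suc (δ q (x 0)) (x ∘ suc) n

Reaches : State → State → 𝒫
Reaches p q x = ∃[ n ] run q (x ↾ n) ≡ p

run-inside : ∀ s → run inside s ≡ inside
run-inside []      = refl
run-inside (_ ∷ s) = run-inside s

run-outside : ∀ s → run outside s ≡ outside
run-outside []      = refl
run-outside (_ ∷ s) = run-outside s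

inside≢outside : ¬ inside ≡ outside
inside≢outside ()

-- Both states are absorbing: after removing common bits one of the runs has arrived, and the other
-- can then only stay there.
reaches-disjoint : ∀ q x → Reaches inside q x → ¬ Reaches outside q x
reaches-disjoint q x (zero , refl)  (n , eq) = inside≢outside (trans (sym (run-inside (x ↾ n))) eq)
reaches-disjoint q x (n , eq)  (zero , refl) = inside≢outside (trans (sym eq) (run-outside (x ↾ n)))
reaches-disjoint q x (suc m , p) (suc n , r) = reaches-disjoint (δ q (x 0)) (x ∘ suc) (m , p) (n , r)

reaches-open : ∀ p q → IsOpen (Reaches p q)
reaches-open p q x (n , eq) = n , λ y∈N → n , trans (cong (run q) (∈N⇒↾≡ n y∈N)) eq

-- Expectations over random bits and the decay of the live states.

-- The expectation of `g` at the state reached from `q` by `n` fair coin tosses.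
expect : (State → ℚ) → ℕ → State → ℚ
expect g zero    q = g q
expect g (suc n) q = avg (expect g n (δ q false)) (expect g n (δ q true))

expect-inside : ∀ g n → expect g n inside ≡ g inside
expect-inside g zero    = refl
expect-inside g (suc n) = trans (avg-idem _) (expect-inside g n)

expect-outside : ∀ g n → expect g n outside ≡ g outside
expect-outside g zero    = refl
expect-outside g (suc n) = trans (avg-idem _) (expect-outside g n)

expect-≤ : ∀ g {r} → (∀ q → g q ≤ r) → ∀ n q → expect g n q ≤ r
expect-≤ g g≤r zero    q = g≤r q
expect-≤ g g≤r (suc n) q = avg-≤ (expect-≤ g g≤r n (δ q false)) (expect-≤ g g≤r n (δ q true))

𝟙inside 𝟙live 𝟙¬outside : State → ℚ
𝟙inside inside    = 1ℚ
𝟙inside outside   = 0ℚ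
𝟙inside (lev _ _) = 0ℚ
𝟙inside (mid _ _) = 0ℚ

𝟙live inside    = 0ℚ
𝟙live outside   = 0ℚ
𝟙live (lev _ _) = 1ℚ
𝟙live (mid _ _) = 1ℚ

𝟙¬outside q = 𝟙inside q + 𝟙live q

0≤1 : 0ℚ ≤ 1ℚ
0≤1 = nonNegative⁻¹ 1ℚ

𝟙live≤1 : ∀ q → 𝟙live q ≤ 1ℚ
𝟙live≤1 inside    = 0≤1
𝟙live≤1 outside   = 0≤1
𝟙live≤1 (lev _ _) = ≤-refl
𝟙live≤1 (mid _ _) = ≤-refl

𝟙¬outside≤1 : ∀ q → 𝟙¬outside q ≤ 1ℚ
𝟙¬outside≤1 inside    = ≤-refl
𝟙¬outside≤1 outside   = 0≤1
𝟙¬outside≤1 (lev _ _) = ≤-refl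
𝟙¬outside≤1 (mid _ _) = ≤-refl

expect-¬outside : ∀ n q → expect 𝟙¬outside n q ≡ expect 𝟙inside n q + expect 𝟙live n q
expect-¬outside zero    q = refl
expect-¬outside (suc n) q = trans (cong₂ avg (expect-¬outside n (δ q false)) (expect-¬outside n (δ q true)))
  (avg-+ (expect 𝟙inside n (δ q false)) (expect 𝟙inside n (δ q true)) _ _)

live-lev : ∀ {n r} → (∀ q → expect 𝟙live n q ≤ r) → ∀ m ℓ → expect 𝟙live (suc n) (lev m ℓ) ≤ ½ * r
live-lev {n} {r} bound m ℓ = ≤-trans
  (avg-mono (bound (mid m ℓ)) (≤-reflexive (expect-inside 𝟙live n)))
  (≤-reflexive (avg-0 r))

-- Among any two consecutive steps of a live run, one leaves a `lev` state or enters `outside`.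
-- Leaving `lev` costs half of the live mass.
live-halves : ∀ {n r} → 0ℚ ≤ r → (∀ q → expect 𝟙live n q ≤ r) → ∀ q → expect 𝟙live (suc (suc n)) q ≤ ½ * r
live-halves {n} 0≤r bound inside    = ≤-trans (≤-reflexive (expect-inside 𝟙live (suc (suc n)))) (*-monoˡ-≤-nonNeg ½ 0≤r)
live-halves {n} 0≤r bound outside   = ≤-trans (≤-reflexive (expect-outside 𝟙live (suc (suc n)))) (*-monoˡ-≤-nonNeg ½ 0≤r)
live-halves {n} 0≤r bound (lev m ℓ) = live-lev {suc n} (λ q → avg-≤ (bound (δ q false)) (bound (δ q true))) m ℓ
live-halves {n} 0≤r bound (mid m zero) = avg-≤
  (≤-trans (≤-reflexive (expect-outside 𝟙live (suc n))) (*-monoˡ-≤-nonNeg ½ 0≤r))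
  (live-lev {n} bound (suc m) (suc m ℕ.+ zero))
live-halves {n} 0≤r bound (mid m (suc ℓ)) = avg-≤ (live-lev {n} bound m ℓ) (live-lev {n} bound (suc m) (suc m ℕ.+ suc ℓ))

live-decay : ∀ m q → expect 𝟙live (m ℕ.* 2) q ≤ ½^ m
live-decay zero    q = 𝟙live≤1 q
live-decay (suc m) q = live-halves {m ℕ.* 2} (0≤½^ m) (live-decay m) q

-- Finite covers of the complement of `V`.

-- The strings of length `n` that do not lead from `q` to `outside`: an approximation from above to
-- the set of points never absorbed there.
boxes : ℕ → State → List (List Bool)
boxes zero    inside    = [] ∷ []
boxes zero    outside   = []
boxes zero    (lev _ _) = [] ∷ []
boxes zero    (mid _ _) = [] ∷ []
boxes (suc n) q         = map (false ∷_) (boxes n (δ q false)) ++ map (true ∷_) (boxes n (δ q true))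

totalVol-boxes : ∀ n q → totalVol (boxes n q) ≡ expect 𝟙¬outside n q
totalVol-boxes zero    inside    = refl
totalVol-boxes zero    outside   = refl
totalVol-boxes zero    (lev _ _) = refl
totalVol-boxes zero    (mid _ _) = refl
totalVol-boxes (suc n) q = begin
  totalVol (map (false ∷_) L ++ map (true ∷_) M)               ≡⟨ totalVol-++ (map (false ∷_) L) (map (true ∷_) M) ⟩
  totalVol (map (false ∷_) L) + totalVol (map (true ∷_) M)     ≡⟨ cong₂ _+_ (totalVol-map false L) (totalVol-map true M) ⟩
  ½ * totalVol L + ½ * totalVol M                              ≡⟨ *-distribˡ-+ ½ (totalVol L) (totalVol M) ⟨
  avg (totalVol L) (totalVol M)                                ≡⟨ cong₂ avg (totalVol-boxes n (δ q false)) (totalVol-boxes n (δ q true)) ⟩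
  expect 𝟙¬outside (suc n) q                                   ∎
  where
  open ≡-Reasoning
  L = boxes n (δ q false)
  M = boxes n (δ q true)

any-map-∷ : ∀ {x b L} → x 0 ≡ b → Any (λ s → (x ∘ suc) ∈ N s) L → Any (λ s → x ∈ N s) (map (b ∷_) L)
any-map-∷ {x} x0≡b = Any.map⁺ ∘ Any.map (∈N-∷ {x = x} x0≡b)

boxes-cover : ∀ n q {x} → ¬ Reaches outside q x → Any (λ s → x ∈ N s) (boxes n q)
boxes-cover zero    inside    _  = here refl
boxes-cover zero    outside   ∉V = contradiction (0 , refl) ∉V
boxes-cover zero    (lev _ _) _  = here refl
boxes-cover zero    (mid _ _) _  = here refl
boxes-cover (suc n) q {x}     ∉V with x 0 in x0≡b
... | false = Any.++⁺ˡ (any-map-∷ {x} x0≡b (boxes-cover n (δ q false)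
  λ (m , eq) → ∉V (suc m , trans (cong (λ b → run (δ q b) ((x ∘ suc) ↾ m)) x0≡b) eq)))
... | true  = Any.++⁺ʳ (map (false ∷_) (boxes n (δ q false))) (any-map-∷ {x} x0≡b (boxes-cover n (δ q true)
  λ (m , eq) → ∉V (suc m , trans (cong (λ b → run (δ q b) ((x ∘ suc) ↾ m)) x0≡b) eq)))

boxesIn : ℕ → State → List Bool → List (List Bool)
boxesIn n q []      = boxes n q
boxesIn n q (b ∷ s) = map (b ∷_) (boxesIn n (δ q b) s)

totalVol-boxesIn : ∀ n q s → totalVol (boxesIn n q s) ≡ expect 𝟙¬outside n (run q s) * vol s
totalVol-boxesIn n q []      = trans (totalVol-boxes n q) (sym (*-identityʳ _))
totalVol-boxesIn n q (b ∷ s) = begin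
  totalVol (map (b ∷_) (boxesIn n (δ q b) s))  ≡⟨ totalVol-map b (boxesIn n (δ q b) s) ⟩
  ½ * totalVol (boxesIn n (δ q b) s)           ≡⟨ cong (½ *_) (totalVol-boxesIn n (δ q b) s) ⟩
  ½ * (e * vol s)                              ≡⟨ solve 2 (λ e v → con ½ :* (e :* v) := e :* (con ½ :* v)) refl e (vol s) ⟩
  e * (½ * vol s)                              ∎
  where
  open ≡-Reasoning
  e = expect 𝟙¬outside n (run (δ q b) s)

boxesIn-cover : ∀ n q s {x} → x ∈ ∁ (Reaches outside q) ∩ N s → Any (λ t → x ∈ N t) (boxesIn n q s)
boxesIn-cover n q []      (∉V , _)   = boxes-cover n q ∉V
boxesIn-cover n q (b ∷ s) {x} (∉V , x∈N) with ∷-injective x∈N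
... | refl , tail∈N = any-map-∷ {x} refl (boxesIn-cover n (δ q b) s ((λ (m , eq) → ∉V (suc m , eq)) , tail∈N))

coverable-∁outside : ∀ n q s → CoverableWithin (∁ (Reaches outside q) ∩ N s) (expect 𝟙¬outside n (run q s) * vol s)
coverable-∁outside n q s = subst (CoverableWithin _) (totalVol-boxesIn n q s)
  (coverable-list (∁ (Reaches outside q) ∩ N s) (boxesIn n q s) (boxesIn-cover n q s))

-- Bounds on the probability of ending outside.

-- A potential that dominates the probability of ending outside. At `mid` it is doubled, because
-- `lev` sends only half of its mass there and the other half to `inside`, where the potential is 0.
ψ : State → ℚ
ψ inside    = 0ℚ
ψ outside   = 1ℚ
ψ (lev _ ℓ) = ½^ ℓ
ψ (mid _ ℓ) = ½^ ℓ + ½^ ℓ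

ψ-supermartingale : ∀ q → avg (ψ (δ q false)) (ψ (δ q true)) ≤ ψ q
ψ-supermartingale inside  = ≤-refl
ψ-supermartingale outside = ≤-refl
ψ-supermartingale (lev n ℓ) = ≤-reflexive (trans (avg-0 (ψ (mid n ℓ))) (avg-idem (½^ ℓ)))
ψ-supermartingale (mid n zero) = ≤-trans (avg-≤ ≤-refl (½^≤1 (suc n ℕ.+ 0))) (+-monoʳ-≤ 1ℚ 0≤1)
ψ-supermartingale (mid n (suc ℓ)) = ≤-trans
  -- The target is `½^ ℓ`, as `ψ` at `mid n (suc ℓ)` is twice `½^ suc ℓ`; it suffices that each
  -- branch is at most that.
  (avg-≤ ≤-refl (≤-trans (½^-+-≤ (suc n) (suc ℓ)) (½^-suc-≤ ℓ)))
  (≤-reflexive (trans (sym (avg-idem (½^ ℓ))) (*-distribˡ-+ ½ (½^ ℓ) (½^ ℓ))))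

-- At time 0 it holds because `ψ` is 1 at `outside`; the supermartingale inequality carries it
-- through every step. The bound is uniform in `n`, hence survives in the limit.
1≤¬outside+ψ : ∀ n q → 1ℚ ≤ expect 𝟙¬outside n q + ψ q
1≤¬outside+ψ zero inside    = ≤-refl
1≤¬outside+ψ zero outside   = ≤-refl
1≤¬outside+ψ zero (lev _ ℓ) = +-monoʳ-≤ 1ℚ (0≤½^ ℓ)
1≤¬outside+ψ zero (mid _ ℓ) = +-monoʳ-≤ 1ℚ (+-mono-≤ (0≤½^ ℓ) (0≤½^ ℓ))
1≤¬outside+ψ (suc n) q = begin
  1ℚ                                                    ≤⟨ ≤-avg (1≤¬outside+ψ n q₀) (1≤¬outside+ψ n q₁) ⟩
  avg (expect 𝟙¬outside n q₀ + ψ q₀) (expect 𝟙¬outside n q₁ + ψ q₁)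
                                                        ≡⟨ avg-+ (expect 𝟙¬outside n q₀) (expect 𝟙¬outside n q₁) (ψ q₀) (ψ q₁) ⟩
  expect 𝟙¬outside (suc n) q + avg (ψ q₀) (ψ q₁)        ≤⟨ +-monoʳ-≤ (expect 𝟙¬outside (suc n) q) (ψ-supermartingale q) ⟩
  expect 𝟙¬outside (suc n) q + ψ q                      ∎
  where
  open ≤-Reasoning
  q₀ = δ q false
  q₁ = δ q true

-- Expresses that `outside` is reached within `n` bits with probability at least `½^ k`.
Loses : ℕ → ℕ → State → Set
Loses n k q = expect 𝟙¬outside n q + ½^ k ≤ 1ℚ

loses-step : ∀ {n k} q → Loses n k (δ q false) → Loses (suc n) (suc k) q
loses-step {n} {k} q loses = begin
  avg e₀ e₁ + ½^ suc k        ≡⟨ solve 3 (λ a b h → con ½ :* (a :+ b) :+ con ½ :* h := con ½ :* ((a :+ h) :+ b)) refl e₀ e₁ (½^ k) ⟩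
  avg (e₀ + ½^ k) e₁          ≤⟨ avg-≤ loses (expect-≤ 𝟙¬outside 𝟙¬outside≤1 n (δ q true)) ⟩
  1ℚ                          ∎
  where
  open ≤-Reasoning
  e₀ = expect 𝟙¬outside n (δ q false)
  e₁ = expect 𝟙¬outside n (δ q true)

-- Two `false` bits lower the level by one, and from level 0 they lead outside. The bound comes from
-- this one path and does not depend on the stage `m`.
loses-lev : ∀ m ℓ → Loses (suc ℓ ℕ.* 2) (suc ℓ ℕ.* 2) (lev m ℓ)
loses-lev m zero    = loses-step {1} {1} (lev m 0) (loses-step {0} {0} (mid m 0) ≤-refl)
loses-lev m (suc ℓ) = loses-step {suc (suc ℓ ℕ.* 2)} {suc (suc ℓ ℕ.* 2)} (lev m (suc ℓ)) (loses-step {suc ℓ ℕ.* 2} {suc ℓ ℕ.* 2} (mid m (suc ℓ)) (loses-lev m ℓ))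

initial : State
initial = lev 0 0

U V : 𝒫
U = Reaches inside initial
V = Reaches outside initial

U⊆∁V : U ⊆ ∁ V
U⊆∁V {x} = reaches-disjoint initial x

-- Compactness and lower bounds for the measure of `U`.

module _ (em : ExcludedMiddle 0ℓ) where

  byContradiction : {P : Set} → ¬ ¬ P → P
  byContradiction = decidable-stable em

  ¬∀⟶∃¬ : {A : Set} {P Q : A → Set} → ¬ (∀ a → P a → Q a) → ∃[ a ] (P a × ¬ Q a)
  ¬∀⟶∃¬ ¬∀ = byContradiction λ ¬∃ → ¬∀ λ a pa → byContradiction λ ¬qa → ¬∃ (a , pa , ¬qa)

  -- Compactness by bisection: if all partial sums stay below 1, the same
  -- holds for one of the two shifts; iterating gives an uncovered point.
  Full : Family → Set
  Full c = ∃[ k ] 1ℚ ≤ partialSum c k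

  Deficient : Set
  Deficient = Σ[ c ∈ Family ] (¬ Full c)

  deficient-half : ((c , _) : Deficient) → ∃[ b ] (¬ Full (shift b c))
  deficient-half (c , deficient) with em {Full (shift false c)}
  ... | no ¬full  = false , ¬full
  ... | yes full₀ = true , λ full₁ → deficient (partialSum-combine c full₀ full₁)

  deficient-next : Deficient → Deficient
  deficient-next D@(c , _) = let b , ¬full = deficient-half D in shift b c , ¬full

  escape : Deficient → Cantor
  escape D zero    = proj₁ (deficient-half D)
  escape D (suc n) = escape (deficient-next D) n

  -- Following the bits of the escaping point keeps the family deficient, while a box around the
  -- point shrinks to the empty string, whose volume 1 is already too much.
  escape-uncovered : ∀ D {k} s → proj₁ D k ≡ just s → escape D ∈ N s → ⊥
  escape-uncovered D@(c , deficient) {k} [] eq _ = deficient (suc k , (begin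
    1ℚ                                 ≡⟨ +-identityˡ 1ℚ ⟨
    0ℚ + 1ℚ                            ≤⟨ +-mono-≤ (0≤partialSum c k) (≤-reflexive (sym (cong volMaybe eq))) ⟩
    partialSum c k + volMaybe (c k)    ∎))
    where open ≤-Reasoning
  escape-uncovered D@(c , _) (b ∷ s) eq ∈N with ∷-injective ∈N
  ... | refl , tail∈N = escape-uncovered (deficient-next D) s (trans (cong (_>>= strip b) eq) (strip-∷ b s)) tail∈N

  full-cover : ∀ c → (∀ x → ∃[ k ] ∃[ s ] (c k ≡ just s × x ∈ N s)) → Full c
  full-cover c covers = byContradiction λ deficient →
    let _ , s , eq , x∈s = covers (escape (c , deficient)) in escape-uncovered (c , deficient) s eq x∈s

  -- On a branch that is `inside` after `n` bits everything has to be covered, and compactness gives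
  -- volume 1; every other branch contributes 0.
  cover-inside : ∀ n q c → Covers c (Reaches inside q) → ∃[ k ] expect 𝟙inside n q ≤ partialSum c k
  cover-inside zero inside    c covers = full-cover c λ x → covers x (0 , refl)
  cover-inside zero outside   c covers = 0 , ≤-refl
  cover-inside zero (lev _ _) c covers = 0 , ≤-refl
  cover-inside zero (mid _ _) c covers = 0 , ≤-refl
  cover-inside (suc n) q c covers = partialSum-combine c (half false) (half true)
    where
    half : ∀ b → ∃[ k ] expect 𝟙inside n (δ q b) ≤ partialSum (shift b c) k
    half b = cover-inside n (δ q b) (shift b c) λ x (m , eq) → shift-covers c b x (covers (b ◂ x) (suc m , eq))

  cover-inside-∩ : ∀ n q s c {r} → Covers c (Reaches inside q ∩ N s) → (∀ k → partialSum c k ≤ r) →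
                   expect 𝟙inside n (run q s) * vol s ≤ r
  cover-inside-∩ n q [] c covers bound =
    let k , e≤ = cover-inside n q c λ x x∈U → covers x (x∈U , refl)
    in ≤-trans (≤-reflexive (*-identityʳ _)) (≤-trans e≤ (bound k))
  cover-inside-∩ n q (b ∷ s) c {r} covers bound = begin
    e * (½ * vol s)    ≡⟨ solve 2 (λ e v → e :* (con ½ :* v) := con ½ :* (e :* v)) refl e (vol s) ⟩
    ½ * (e * vol s)    ≤⟨ *-monoˡ-≤-nonNeg ½ (cover-inside-∩ n (δ q b) s (shift b c) covers′ bound′) ⟩
    ½ * (r + r)        ≡⟨ avg-idem r ⟩
    r                  ∎
    where
    open ≤-Reasoning
    e = expect 𝟙inside n (run (δ q b) s)
    covers′ : Covers (shift b c) (Reaches inside (δ q b) ∩ N s)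
    covers′ x ((m , eq) , x∈s) = shift-covers c b x (covers (b ◂ x) ((suc m , eq) , cong (b ∷_) x∈s))
    -- Passing to a half space doubles relative volume, so the bound `r` becomes `r + r`; the mean
    -- taken in the main chain undoes this.
    bound′ : ∀ k → partialSum (shift b c) k ≤ r + r
    bound′ k = begin
      p                  ≡⟨ avg-idem p ⟨
      ½ * (p + p)        ≡⟨ *-distribˡ-+ ½ p p ⟩
      ½ * p + ½ * p      ≤⟨ +-mono-≤ ½p≤r ½p≤r ⟩
      r + r              ∎
      where
      p = partialSum (shift b c) k
      ½p≤r = ≤-trans (partialSum-½-shift c b k) (bound k)

  -- The live states have vanishing probability, so U has as much measure as ∁ V.
  ≤μ-inside : ∀ {a} q s → (∀ n → a ≤ expect 𝟙¬outside n (run q s) * vol s) → a ≤μ Reaches inside q ∩ N s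
  ≤μ-inside {a} q s a≤ r (c , covers , bound) = ≤-½^-slack λ m →
    let n = m ℕ.* 2
        u = expect 𝟙inside n (run q s)
        k = expect 𝟙live n (run q s)
    in begin
    a                                       ≤⟨ a≤ n ⟩
    expect 𝟙¬outside n (run q s) * vol s    ≡⟨ cong (_* vol s) (expect-¬outside n (run q s)) ⟩
    (u + k) * vol s                         ≡⟨ *-distribʳ-+ (vol s) u k ⟩
    u * vol s + k * vol s                   ≤⟨ +-mono-≤ (cover-inside-∩ n q s c covers bound) (*-vol-mono s (live-decay m (run q s))) ⟩
    r + ½^ m * vol s                        ≤⟨ +-monoʳ-≤ r (*-monoˡ-≤-nonNeg (½^ m) {{nonNegative (0≤½^ m)}} (vol≤1 s)) ⟩
    r + ½^ m * 1ℚ                           ≡⟨ cong (r +_) (*-identityʳ (½^ m)) ⟩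
    r + ½^ m                                ∎
    where open ≤-Reasoning

  -- Density points of `U` and of `∁ V`.

  ∁V-closed : IsClosed (∁ V)
  ∁V-closed x ¬¬x∈V = let n , N⊆V = reaches-open outside initial x (byContradiction ¬¬x∈V) in
    n , λ y∈N y∉V → y∉V (N⊆V y∈N)

  -- One inclusion is monotonicity. For the other, density of `∁ V` bounds the volume of each of its
  -- finite covers from below, and these volumes approximate the measure of `U`.
  ΦU≐Φ∁V : Φ U ≐ Φ (∁ V)
  ΦU≐Φ∁V = U⊆ , ∁V⊆
    where
    U⊆ : Φ U ⊆ Φ (∁ V)
    U⊆ {x} x∈ΦU ε 0<ε = let m , dense = x∈ΦU ε 0<ε in
      m , λ n m≤n → (λ r cov → proj₁ (dense n m≤n) r (coverable-mono (λ {y} (y∈U , y∈N) → U⊆∁V {y} y∈U , y∈N) cov))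
                  , density-upper (∁ V) (x ↾ n) (<⇒≤ 0<ε)
    ∁V⊆ : Φ (∁ V) ⊆ Φ U
    ∁V⊆ {x} x∈Φ ε 0<ε = let m , dense = x∈Φ ε 0<ε in
      m , λ n m≤n → ≤μ-inside initial (x ↾ n) (λ k → proj₁ (dense n m≤n) _ (coverable-∁outside k initial (x ↾ n)))
                  , density-upper U (x ↾ n) (<⇒≤ 0<ε)

  -- Tolerances `½^ i` suffice, as the lower density bound weakens when the tolerance grows. For
  -- fixed `i` and `j` the condition is closed: a failure shows at some prefix `x ↾ n` and is shared
  -- by all points with that prefix.
  Φ-Π⁰₃ : ∀ A → Π⁰₃ (Φ A)
  Φ-Π⁰₃ A = F , F-closed , Φ⊆ , ⊆Φ
    where
    F : ℕ → ℕ → 𝒫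
    F i j x = ∀ n → j ℕ.≤ n → DensityWithin A (½^ i) (x ↾ n)
    F-closed : ∀ i j → IsClosed (F i j)
    F-closed i j x x∉F = let n , j≤n , ¬dense = ¬∀⟶∃¬ x∉F in
      n , λ y∈N y∈F → ¬dense (subst (DensityWithin A (½^ i)) (∈N⇒↾≡ n y∈N) (y∈F n j≤n))
    Φ⊆ : Φ A ⊆ (⋂[ i ∶ ℕ ] ⋃[ j ∶ ℕ ] F i j)
    Φ⊆ x∈Φ i = x∈Φ (½^ i) (0<½^ i)
    ⊆Φ : (⋂[ i ∶ ℕ ] ⋃[ j ∶ ℕ ] F i j) ⊆ Φ A
    ⊆Φ {x} x∈F ε 0<ε = let i , ½^i<ε = archimedean ε 0<ε
                           j , dense = x∈F i in
      j , λ n j≤n → (λ r cov → ≤-trans (*-vol-mono (x ↾ n) (+-monoʳ-≤ 1ℚ (neg-antimono-≤ (<⇒≤ ½^i<ε)))) (proj₁ (dense n j≤n) r cov))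
                  , density-upper A (x ↾ n) (<⇒≤ 0<ε)

  small-ψ⇒∈ΦU : ∀ x → (∀ i → ∃[ m ] (∀ n → m ℕ.≤ n → ψ (run initial (x ↾ n)) ≤ ½^ i)) → x ∈ Φ U
  small-ψ⇒∈ΦU x small ε 0<ε = let i , ½^i<ε = archimedean ε 0<ε
                                  m , ψ≤ = small i in
    m , λ n m≤n → ≤μ-inside initial (x ↾ n) (λ k → *-vol-mono (x ↾ n) (1-ε≤ k (run initial (x ↾ n)) (≤-trans (ψ≤ n m≤n) (<⇒≤ ½^i<ε))))
                , density-upper U (x ↾ n) (<⇒≤ 0<ε)
    where
    1-ε≤ : ∀ k q → ψ q ≤ ε → 1ℚ - ε ≤ expect 𝟙¬outside k q
    1-ε≤ k q ψ≤ε = begin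
      1ℚ - ε            ≤⟨ +-mono-≤ (1≤¬outside+ψ k q) (neg-antimono-≤ ψ≤ε) ⟩
      (e + ψ q) - ψ q   ≡⟨ solve 2 (λ e p → (e :+ p) :- p := e) refl e (ψ q) ⟩
      e                 ∎
      where
      open ≤-Reasoning
      e = expect 𝟙¬outside k q

  -- At each visit to level `ℓ` the set `U` misses at least the fraction `½^ k` of the box, by
  -- `loses-lev`. Half of that fraction serves as the tolerance that fails infinitely often.
  recurrent-level⇒∉ΦU : ∀ x ℓ → (∀ m → ∃[ n ] (m ℕ.≤ n × ∃[ j ] run initial (x ↾ n) ≡ lev j ℓ)) → ¬ x ∈ Φ U
  recurrent-level⇒∉ΦU x ℓ recurrent x∈ΦU =
    let m , dense = x∈ΦU (½^ suc k) (0<½^ (suc k))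
        n , m≤n , j , at-lev = recurrent m
        s = x ↾ n
        e = expect 𝟙¬outside k (run initial s)
        1-ε≤e : 1ℚ - ½^ suc k ≤ e
        1-ε≤e = *-vol-cancel s (proj₁ (dense n m≤n) (e * vol s)
          (coverable-mono (λ {y} (y∈U , y∈N) → U⊆∁V {y} y∈U , y∈N) (coverable-∁outside k initial s)))
        e+½^k≤1 : e + ½^ k ≤ 1ℚ
        e+½^k≤1 = subst (Loses k k) (sym at-lev) (loses-lev j ℓ)
    in <-irrefl refl (begin-strict
      ½^ k                                                        ≡⟨ solve 2 (λ e h → h := (e :+ h) :- e) refl e (½^ k) ⟩
      (e + ½^ k) - e                                              ≤⟨ +-mono-≤ e+½^k≤1 (neg-antimono-≤ 1-ε≤e) ⟩
      1ℚ - (1ℚ - ½^ suc k)                                        ≡⟨ solve 1 (λ h → con 1ℚ :- (con 1ℚ :- h) := h) refl (½^ suc k) ⟩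
      ½^ suc k                                                    <⟨ ½^-suc-< k ⟩
      ½^ k                                                        ∎)
    where
    open ≤-Reasoning
    k = suc ℓ ℕ.* 2

-- Prefixes and invariants of states.

↾-≤ : ∀ {x y} {m n} → m ℕ.≤ n → x ↾ n ≡ y ↾ n → x ↾ m ≡ y ↾ m
↾-≤ z≤n       _  = refl
↾-≤ (s≤s m≤n) eq = let x0≡y0 , eq′ = ∷-injective eq in cong₂ _∷_ x0≡y0 (↾-≤ m≤n eq′)

↾-cong : ∀ {x y} n → (∀ k → k ℕ.< n → x k ≡ y k) → x ↾ n ≡ y ↾ n
↾-cong zero    _  = refl
↾-cong (suc n) eq = cong₂ _∷_ (eq 0 (s≤s z≤n)) (↾-cong n λ k k<n → eq (suc k) (s≤s k<n))

-- With the stage bounded by the time `t`, the steering bit at time `t` consults only `y ↾ t`; this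
-- is what makes the reduction continuous.
StageAtMost : ℕ → State → Set
StageAtMost t inside    = ⊤
StageAtMost t outside   = ⊤
StageAtMost t (lev n _) = n ℕ.≤ t
StageAtMost t (mid n _) = n ℕ.≤ t

δ-stageAtMost : ∀ {t} q b → StageAtMost t q → StageAtMost (suc t) (δ q b)
δ-stageAtMost inside          b     _   = tt
δ-stageAtMost outside         b     _   = tt
δ-stageAtMost (lev n ℓ)       true  _   = tt
δ-stageAtMost (lev n ℓ)       false n≤t = ℕ.m≤n⇒m≤1+n n≤t
δ-stageAtMost (mid n ℓ)       true  n≤t = s≤s n≤t
δ-stageAtMost (mid n zero)    false _   = tt
δ-stageAtMost (mid n (suc ℓ)) false n≤t = ℕ.m≤n⇒m≤1+n n≤t

Above : ℕ → ℕ → State → Set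
Above n₀ M inside    = ⊥
Above n₀ M outside   = ⊥
Above n₀ M (lev n ℓ) = n₀ ℕ.≤ n × M ℕ.≤ ℓ
Above n₀ M (mid n ℓ) = n₀ ℕ.≤ n × M ℕ.≤ ℓ

-- The extra level pays for the factor 2 of `ψ` at `mid`.
ψ-above : ∀ {n₀} M q → Above n₀ (suc M) q → ψ q ≤ ½^ M
ψ-above M (lev n ℓ) (_ , M<ℓ) = ½^-anti (ℕ.<⇒≤ M<ℓ)
ψ-above M (mid n ℓ) (_ , M<ℓ) = ≤-trans (+-mono-≤ (½^-anti M<ℓ) (½^-anti M<ℓ))
  (≤-reflexive (trans (sym (*-distribˡ-+ ½ (½^ M) (½^ M))) (avg-idem (½^ M))))

-- The reduction: candidates, steering and continuity.

module Reduction (em : ExcludedMiddle 0ℓ) (F : ℕ → ℕ → 𝒫) (F-closed : ∀ i j → IsClosed (F i j)) where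

  Refuted : ℕ → ℕ → List Bool → Set
  Refuted i j s = ∀ x → x ∈ N s → ¬ x ∈ F i j

  advance : ℕ → ℕ → List Bool → ℕ
  advance i j s = if does (em {Refuted i j s}) then suc j else j

  -- The least j for which y ∈ F i j has not been refuted, checking one j per stage.
  candidate : Cantor → ℕ → ℕ → ℕ
  candidate y i zero    = 0
  candidate y i (suc n) = advance i (candidate y i n) (y ↾ n)

  Changes : Cantor → ℕ → ℕ → Set
  Changes y i n = Refuted i (candidate y i n) (y ↾ n)

  -- The row must lie strictly below the current level, so repeated descent stops exactly at the
  -- least changing row.
  Descends : Cantor → ℕ → ℕ → Set
  Descends y n ℓ = ∃[ i ] (i ℕ.< ℓ × Changes y i n)

  move : Cantor → State → Bool
  move y (mid n ℓ) = not (does (em {Descends y n ℓ}))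
  -- At `lev` the bit `false` avoids absorption inside.
  move y _         = false

  walk : Cantor → ℕ → State
  walk y zero    = initial
  walk y (suc t) = δ (walk y t) (move y (walk y t))

  encode : Cantor → Cantor
  encode y t = move y (walk y t)

  run-encode : ∀ y t → run initial (encode y ↾ t) ≡ walk y t
  run-encode y zero    = refl
  run-encode y (suc t) = trans (run-↾-suc initial (encode y) t) (cong (λ q → δ q (encode y t)) (run-encode y t))

  candidate-local : ∀ {y z} i n → y ↾ n ≡ z ↾ n → candidate y i n ≡ candidate z i n
  candidate-local i zero    _  = refl
  candidate-local {y} {z} i (suc n) eq = cong₂ (advance i) (candidate-local i n eq′) eq′
    where eq′ = ↾-≤ {y} {z} (ℕ.n≤1+n n) eq

  descends-local : ∀ {y z} n ℓ → y ↾ n ≡ z ↾ n → Descends y n ℓ → Descends z n ℓ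
  descends-local n ℓ eq (i , i<ℓ , changes) = i , i<ℓ , subst₂ (λ j s → Refuted i j s) (candidate-local i n eq) eq changes

  move-local : ∀ {y z t} q → StageAtMost t q → y ↾ t ≡ z ↾ t → move y q ≡ move z q
  move-local inside    _   _  = refl
  move-local outside   _   _  = refl
  move-local (lev _ _) _   _  = refl
  move-local {y} {z} (mid n ℓ) n≤t eq = cong not (does-⇔ (mk⇔ (descends-local n ℓ eq′) (descends-local n ℓ (sym eq′))) em em)
    where eq′ = ↾-≤ {y} {z} n≤t eq

  walk-stageAtMost : ∀ y t → StageAtMost t (walk y t)
  walk-stageAtMost y zero    = z≤n
  walk-stageAtMost y (suc t) = δ-stageAtMost (walk y t) (move y (walk y t)) (walk-stageAtMost y t)

  encode-local : ∀ {y z} t → walk y t ≡ walk z t → y ↾ t ≡ z ↾ t → encode y t ≡ encode z t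
  encode-local {y} {z} t walk≡ eq = trans (move-local (walk y t) (walk-stageAtMost y t) eq) (cong (move z) walk≡)

  walk-local : ∀ {y z} t → y ↾ t ≡ z ↾ t → walk y t ≡ walk z t
  walk-local zero    _  = refl
  walk-local {y} {z} (suc t) eq = cong₂ δ walk≡ (encode-local t walk≡ eq′)
    where
    eq′ = ↾-≤ {y} {z} (ℕ.n≤1+n t) eq
    walk≡ = walk-local t eq′

  -- Bit `k` of the code depends only on `y ↾ k`, so `n` bits of input determine `n` bits of output.
  encode-continuous : Continuous encode
  encode-continuous x n = n , λ {y} y∈N →
    let agree = λ k k<n → ↾-≤ {y} {x} (ℕ.<⇒≤ k<n) (∈N⇒↾≡ n y∈N)
        eq    = ↾-cong n λ k k<n → encode-local k (walk-local k (agree k k<n)) (agree k k<n)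
    in trans (cong (encode y ↾_) (length-applyUpTo (encode x) n)) eq

  -- The levels visited by the steered machine.

  up : ∀ y n ℓ → ¬ Descends y n ℓ → δ (mid n ℓ) (move y (mid n ℓ)) ≡ lev (suc n) (suc n ℕ.+ ℓ)
  up y n ℓ ¬descends with em {Descends y n ℓ}
  ... | yes descends = contradiction descends ¬descends
  ... | no  _        = refl

  down : ∀ y n ℓ → Descends y n (suc ℓ) → δ (mid n (suc ℓ)) (move y (mid n (suc ℓ))) ≡ lev n ℓ
  down y n ℓ descends with em {Descends y n (suc ℓ)}
  ... | yes _         = refl
  ... | no  ¬descends = contradiction descends ¬descends

  walk-up : ∀ {y t n ℓ} → walk y t ≡ lev n ℓ → ¬ Descends y n ℓ → walk y (suc (suc t)) ≡ lev (suc n) (suc n ℕ.+ ℓ)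
  walk-up {y} {t} {n} {ℓ} eq ¬descends rewrite eq = up y n ℓ ¬descends

  walk-down : ∀ {y t n ℓ} → walk y t ≡ lev n (suc ℓ) → Descends y n (suc ℓ) → walk y (suc (suc t)) ≡ lev n ℓ
  walk-down {y} {t} {n} {ℓ} eq descends rewrite eq = down y n ℓ descends

  -- Induction on the level: each descent lowers it, and at level 0 no row lies below, so the walk
  -- must go up. In particular it never falls outside.
  next-stage : ∀ {y n} ℓ t → walk y t ≡ lev n ℓ → ∃[ t′ ] (t ℕ.< t′ × ∃[ ℓ′ ] walk y t′ ≡ lev (suc n) (suc n ℕ.+ ℓ′))
  next-stage {y} zero t eq = suc (suc t) , ℕ.m<n⇒m<1+n (ℕ.n<1+n t) , zero , walk-up {y} {t} eq λ ()
  next-stage {y} {n} (suc ℓ) t eq with em {Descends y n (suc ℓ)}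
  ... | no ¬descends = suc (suc t) , ℕ.m<n⇒m<1+n (ℕ.n<1+n t) , suc ℓ , walk-up {y} {t} eq ¬descends
  ... | yes descends = let t′ , t<t′ , at = next-stage ℓ (suc (suc t)) (walk-down {y} {t} eq descends) in
    t′ , ℕ.<-trans (ℕ.m<n⇒m<1+n (ℕ.n<1+n t)) t<t′ , at

  stage-start : ∀ y n → ∃[ t ] (n ℕ.≤ t × ∃[ ℓ ] walk y t ≡ lev n (n ℕ.+ ℓ))
  stage-start y zero    = 0 , z≤n , 0 , refl
  stage-start y (suc n) = let t , n≤t , ℓ , at = stage-start y n
                              t′ , t<t′ , at′ = next-stage (n ℕ.+ ℓ) t at in
    t′ , ℕ.≤-<-trans n≤t t<t′ , at′

  -- While the level exceeds `i`, row `i` itself is a reason to descend, so stage `n` cannot end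
  -- earlier.
  descend : ∀ {y i n} → Changes y i n → ∀ k t → walk y t ≡ lev n (k ℕ.+ i) → ∃[ t′ ] (t ℕ.≤ t′ × walk y t′ ≡ lev n i)
  descend changes zero    t eq = t , ℕ.≤-refl , eq
  descend {y} {i} changes (suc k) t eq =
    let t′ , t+2≤t′ , at = descend changes k (suc (suc t)) (walk-down {y} {t} eq (i , s≤s (ℕ.m≤n+m i k) , changes)) in
    t′ , ℕ.≤-trans (ℕ.m≤n⇒m≤1+n (ℕ.n≤1+n t)) t+2≤t′ , at

  visits : ∀ {y i n} → i ℕ.≤ n → Changes y i n → ∃[ t ] (n ℕ.≤ t × walk y t ≡ lev n i)
  visits {y} {i} {n} i≤n changes =
    let t , n≤t , ℓ , at = stage-start y n
        t′ , t≤t′ , at′ = descend changes ((n ℕ.+ ℓ) ℕ.∸ i) t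
          (trans at (cong (lev n) (sym (ℕ.m∸n+n≡m (ℕ.≤-trans i≤n (ℕ.m≤m+n n ℓ))))))
    in t′ , ℕ.≤-trans n≤t t≤t′ , at′

  Quiet : Cantor → ℕ → ℕ → Set
  Quiet y i n₀ = ∀ n → n₀ ℕ.≤ n → ¬ Changes y i n

  -- Upward moves raise the level. A descent is caused by a changing row no larger than the new
  -- level, and rows below `M` no longer change.
  above-step : ∀ {y n₀ M} → M ℕ.≤ n₀ → (∀ i → i ℕ.< M → Quiet y i n₀) → ∀ q → Above n₀ M q → Above n₀ M (δ q (move y q))
  above-step M≤n₀ quiet (lev n ℓ) above = above
  above-step {y} M≤n₀ quiet (mid n ℓ) (n₀≤n , M≤ℓ) with em {Descends y n ℓ}
  ... | no _ = ℕ.m≤n⇒m≤1+n n₀≤n , ℕ.≤-trans M≤ℓ (ℕ.m≤n+m ℓ (suc n))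
  above-step M≤n₀ quiet (mid n (suc ℓ)) (n₀≤n , M≤ℓ) | yes (i , s≤s i≤ℓ , changes) =
    n₀≤n , ℕ.≤-trans (ℕ.≮⇒≥ λ i<M → quiet i i<M n n₀≤n changes) i≤ℓ

  above-after : ∀ {y n₀ M t} → M ℕ.≤ n₀ → (∀ i → i ℕ.< M → Quiet y i n₀) → Above n₀ M (walk y t) →
                ∀ k → Above n₀ M (walk y (k ℕ.+ t))
  above-after M≤n₀ quiet above zero    = above
  above-after {y} {t = t} M≤n₀ quiet above (suc k) =
    above-step M≤n₀ quiet (walk y (k ℕ.+ t)) (above-after {t = t} M≤n₀ quiet above k)

  -- Convergence of candidates.

  candidate-changes : ∀ {y i n} → Changes y i n → candidate y i (suc n) ≡ suc (candidate y i n)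
  candidate-changes {y} {i} {n} changes with em {Changes y i n}
  ... | yes _        = refl
  ... | no  ¬changes = contradiction changes ¬changes

  candidate-stays : ∀ {y i n} → ¬ Changes y i n → candidate y i (suc n) ≡ candidate y i n
  candidate-stays {y} {i} {n} ¬changes with em {Changes y i n}
  ... | yes changes = contradiction changes ¬changes
  ... | no  _       = refl

  candidate-≤-suc : ∀ y i n → candidate y i n ℕ.≤ candidate y i (suc n)
  candidate-≤-suc y i n with em {Changes y i n}
  ... | yes _ = ℕ.n≤1+n _
  ... | no  _ = ℕ.≤-refl

  candidate-mono-+ : ∀ y i k n → candidate y i n ℕ.≤ candidate y i (k ℕ.+ n)
  candidate-mono-+ y i zero    n = ℕ.≤-refl
  candidate-mono-+ y i (suc k) n = ℕ.≤-trans (candidate-mono-+ y i k n) (candidate-≤-suc y i (k ℕ.+ n))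

  candidate-mono : ∀ y i {m n} → m ℕ.≤ n → candidate y i m ℕ.≤ candidate y i n
  candidate-mono y i {m} {n} m≤n = subst (λ k → candidate y i m ℕ.≤ candidate y i k) (ℕ.m∸n+n≡m m≤n) (candidate-mono-+ y i (n ℕ.∸ m) m)

  -- The candidate cannot pass `j`: the point `y` lies in each of its own boxes and in `F i j`, so
  -- `j` is never refuted.
  candidate-≤ : ∀ {y i j} → y ∈ F i j → ∀ n → candidate y i n ℕ.≤ j
  candidate-≤ y∈F zero = z≤n
  candidate-≤ {y} {i} {j} y∈F (suc n) with em {Changes y i n}
  ... | no  _       = candidate-≤ y∈F n
  ... | yes refuted = ℕ.≤∧≢⇒< (candidate-≤ y∈F n) λ eq →
    refuted y (x∈N[x↾n] y n) (subst (λ k → y ∈ F i k) (sym eq) y∈F)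

  eventually-quiet : ∀ {y i j} → y ∈ F i j → ∃[ n₀ ] Quiet y i n₀
  eventually-quiet {y} {i} {j} y∈F = go j 0 (ℕ.m≤m+n j _)
    where
    -- `k` bounds how often the candidate can still grow before exceeding `j`; each change uses up
    -- one unit.
    go : ∀ k m → j ℕ.≤ k ℕ.+ candidate y i m → ∃[ n₀ ] Quiet y i n₀
    go k m j≤ with em {Quiet y i m}
    ... | yes quiet = m , quiet
    ... | no ¬quiet with ¬∀⟶∃¬ em ¬quiet
    ...   | n , m≤n , ¬¬changes = after k j≤
      where
      c<c : candidate y i m ℕ.< candidate y i (suc n)
      c<c = ℕ.≤-trans (s≤s (candidate-mono y i m≤n)) (ℕ.≤-reflexive (sym (candidate-changes {y} {i} {n} (byContradiction em ¬¬changes))))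
      after : ∀ k → j ℕ.≤ k ℕ.+ candidate y i m → ∃[ n₀ ] Quiet y i n₀
      after zero    j≤ = contradiction (ℕ.≤-<-trans j≤ c<c) (ℕ.≤⇒≯ (candidate-≤ y∈F (suc n)))
      after (suc k) j≤ = go k (suc n) (ℕ.≤-trans j≤ (ℕ.≤-trans (ℕ.≤-reflexive (sym (ℕ.+-suc k _))) (ℕ.+-monoʳ-≤ k c<c)))

  -- From `n₀` on the candidate is constant. If `y` were outside its closed set, some prefix would
  -- refute it; lengthening that prefix past `n₀` contradicts quietness.
  quiet⇒∈ : ∀ {y i n₀} → Quiet y i n₀ → y ∈ F i (candidate y i n₀)
  quiet⇒∈ {y} {i} {n₀} quiet = byContradiction em λ y∉F →
    let n , N⊆∁F = F-closed i (candidate y i n₀) y y∉F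
        refuted : Refuted i (candidate y i n₀) (y ↾ (n ℕ.+ n₀))
        refuted = λ z z∈N → N⊆∁F (trans (cong (z ↾_) (length-applyUpTo y n)) (↾-≤ {z} {y} (ℕ.m≤m+n n n₀) (∈N⇒↾≡ (n ℕ.+ n₀) z∈N)))
    in quiet (n ℕ.+ n₀) (ℕ.m≤n+m n₀ n) (subst (λ j → Refuted i j (y ↾ (n ℕ.+ n₀))) (sym (stable n)) refuted)
    where
    stable : ∀ k → candidate y i (k ℕ.+ n₀) ≡ candidate y i n₀
    stable zero    = refl
    stable (suc k) = trans (candidate-stays {y} {i} {k ℕ.+ n₀} (quiet (k ℕ.+ n₀) (ℕ.m≤n+m n₀ k))) (stable k)

  -- Correctness of the reduction.

  X : 𝒫
  X = ⋂[ i ∶ ℕ ] ⋃[ j ∶ ℕ ] F i j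

  quiet-below : ∀ {y} → y ∈ X → ∀ M → ∃[ n₀ ] (M ℕ.≤ n₀ × (∀ i → i ℕ.< M → Quiet y i n₀))
  quiet-below {y} y∈X zero    = 0 , z≤n , λ _ ()
  quiet-below {y} y∈X (suc M) =
    let n₀ , M≤n₀ , quiet = quiet-below y∈X M
        n₁ , quiet-M      = eventually-quiet {y} {M} (proj₂ (y∈X M))
        n₀≤ = ℕ.m≤n⇒m≤1+n (ℕ.m≤m⊔n n₀ n₁)
    -- The successor secures the bound `suc M`; the maximum keeps all rows up to `M` quiet.
    in suc (n₀ ℕ.⊔ n₁) , s≤s (ℕ.≤-trans M≤n₀ (ℕ.m≤m⊔n n₀ n₁)) , λ i i<1+M n n≥ →
      case ℕ.m<1+n⇒m<n∨m≡n i<1+M of λ where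
        (inj₁ i<M)  → quiet i i<M n (ℕ.≤-trans n₀≤ n≥)
        (inj₂ refl) → quiet-M n (ℕ.≤-trans (ℕ.m≤n⇒m≤1+n (ℕ.m≤n⊔m n₀ n₁)) n≥)

  -- Once the rows up to `M` are quiet, a later stage starts above level `M` and the walk stays
  -- there, which makes `ψ` at most `½^ M`.
  encode-∈ : ∀ {y} → y ∈ X → encode y ∈ Φ U
  encode-∈ {y} y∈X = small-ψ⇒∈ΦU em (encode y) λ M →
    let n₀ , M<n₀ , quiet = quiet-below y∈X (suc M)
        t , _ , ℓ , at = stage-start y n₀
        above = subst (Above n₀ (suc M)) (sym at) (ℕ.≤-refl , ℕ.≤-trans M<n₀ (ℕ.m≤m+n n₀ ℓ))
    in t , λ n t≤n → ψ-above {n₀} M _ (subst (Above n₀ (suc M)) (sym (run-encode y n))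
      (subst (λ k → Above n₀ (suc M) (walk y k)) (ℕ.m∸n+n≡m t≤n) (above-after {t = t} M<n₀ quiet above (n ℕ.∸ t))))

  -- A row `i` that never becomes quiet changes in infinitely many stages, and each such stage from
  -- `i` on visits level `i`.
  encode-∉ : ∀ {y} → encode y ∈ Φ U → y ∈ X
  encode-∉ {y} dense i with em {∃[ n₀ ] Quiet y i n₀}
  ... | yes (n₀ , quiet) = candidate y i n₀ , quiet⇒∈ quiet
  ... | no  ¬quiet = contradiction dense (recurrent-level⇒∉ΦU em (encode y) i λ m →
    -- The maximum makes the visit later than `m` and lets the stage start at level `i` or higher.
    let n , m⊔i≤n , ¬¬changes = ¬∀⟶∃¬ em λ quiet → ¬quiet (m ℕ.⊔ i , quiet)
        t , n≤t , at = visits {y} {i} {n} (ℕ.≤-trans (ℕ.m≤n⊔m m i) m⊔i≤n) (byContradiction em ¬¬changes)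
    in t , ℕ.≤-trans (ℕ.m≤m⊔n m i) (ℕ.≤-trans m⊔i≤n n≤t) , n , trans (run-encode y t) at)

theorem1p2 : ExcludedMiddle 0ℓ →
    Σ[ U ∈ 𝒫 ] Σ[ C ∈ 𝒫 ] (IsOpen U × IsClosed C × Φ U ≐ Φ C × CompleteΠ⁰₃ (Φ U))
theorem1p2 em = U , ∁ V , reaches-open inside initial , ∁V-closed em , ΦU≐Φ∁V em , Φ-Π⁰₃ em U ,
  λ Y (F , F-closed , Y⊆ , ⊆Y) → let open Reduction em F F-closed in
    encode , encode-continuous , (λ y∈Y → encode-∈ (Y⊆ y∈Y)) , λ dense → ⊆Y (encode-∉ dense)
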